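{- Let $(\mathcal{I},\gamma)$ be an inference system with coaxioms on a universe $\mathcal{U}$ and let $j\in\mathcal{U}$ be a judgement. Then the following are equivalent: (1) $j\in \mathit{Gen}(\mathcal{I},\gamma)$; (2) $j$ has a strongly approximating proof sequence; (3) $j$ has an approximating proof sequence $(t_n)_{n\in\mathbb{N}}$ such that $\bigvee_{n\in\mathbb{N}} t_n$ is a proof tree in $\mathcal{I}$.
   Context: Inference systems. Fix a set $\mathcal{U}$ (the universe), whose elements are called judgements. An inference system $\mathcal{I}$ is a set of rules, i.e. pairs $\frac{Pr}{c}$ with $Pr\subseteq\mathcal{U}$ (premises, an arbitrary set) and $c\in\mathcal{U}$ (conclusion). Its inference operator is $F_{\mathcal{I}}:\wp(\mathcal{U})\to\wp(\mathcal{U})$, $F_{\mathcal{I}}(S)=\{c \mid \exists \frac{Pr}{c}\in\mathcal{I},\ Pr\subseteq S\}$. $\mathit{Ind}(\mathcal{I})$ and $\mathit{CoInd}(\mathcal{I})$ are the least and the greatest fixed point of $F_{\mathcal{I}}$. An inference system with coaxioms is a pair $(\mathcal{I},\gamma)$ with $\mathcal{I}$ an inference system and $\gamma\subseteq\mathcal{U}$. $\mathcal{I}_{\sqcup\gamma}=\mathcal{I}\cup\{\frac{\emptyset}{c}\mid c\in\gamma\}$; for $S\subseteq\mathcal{U}$, $\mathcal{I}_{\sqcap S}=\{\frac{Pr}{c}\in\mathcal{I}\mid c\in S\}$. The interpretation generated by coaxioms is $\mathit{Gen}(\mathcal{I},\gamma)=\mathit{CoInd}(\mathcal{I}_{\sqcap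 \mathit{Ind}(\mathcal{I}_{\sqcup\gamma})})$. Trees. For a set $A$, $A^\star$ is the set of finite strings over $A$, $\varepsilon$ the empty string, $|\alpha|$ the length of $\alpha$. A tree language is a non-empty $L\subseteq A^\star$ such that $\alpha a\in L$ implies $\alpha\in L$ ($a\in A$). A tree labelled in a set $\Lambda$ is a function $t:L\to\Lambda$ with $L=\mathit{dom}(t)$ a tree language; its root is $t(\varepsilon)$. For $\alpha\in\mathit{dom}(t)$, $\mathit{chl}_t(\alpha)=\{\alpha a\in \mathit{dom}(t)\mid a\in A\}$. $t$ is well-founded if every subset of $\mathit{dom}(t)$ that is a chain for the prefix order is finite. $t$ is children injective if $t$ restricted to $\mathit{chl}_t(\alpha)$ is injective for all $\alpha\in\mathit{dom}(t)$. Children injective trees labelled in $\Lambda$ are considered up to renaming of alphabet symbols and always taken in canonical form: $A=\Lambda$ and $t(\alpha a)=a$ for all $\alpha a\in\mathit{dom}(t)$. Proof trees. A proof tree in $\mathcal{I}$ is a children injective tree $t$ labelled in $\mathcal{U}$ such that for all $\alpha\in\mathit{dom}(t)$ there is a rule $\frac{Pr}{c}\in\mathcal{I}$ with $t(\alpha)=c$ and $t(\mathit{chl}_t(\alpha))=Pr$. It is a proof tree for $j$ if $t(\varepsilon)=j$. The sets $\mathcal{T}_n$ of approximated proof trees of level $n$ in $(\mathcal{I},\gamma)$ are defined inductively: $\mathcal{T}_0$ is the set of well-founded proof trees in $\mathcal{I}_{\sqcup\gamma}$; $\mathcal{T}_{n+1}$ consists of the trees with root $c$ whose direct subtrees are exactly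 the members of a family $(t_i)_{i\in Pr}$, where $\frac{Pr}{c}\in\mathcal{I}$ and, for each $i\in Pr$, $t_i\in\mathcal{T}_n$ and $t_i(\varepsilon)=i$. Approximations. $\mathit{dom}_n(t)=\{\alpha\in\mathit{dom}(t)\mid |\alpha|\le n\}$. Write $t\triangleleft t'$ if $\mathit{dom}(t)\subseteq\mathit{dom}(t')$ and $t(\alpha)=t'(\alpha)$ for all $\alpha\in\mathit{dom}(t)$; write $t\triangleleft_n t'$ if $\mathit{dom}_n(t)\subseteq\mathit{dom}_n(t')$ and $t(\alpha)=t'(\alpha)$ for all $\alpha\in\mathit{dom}_n(t)$; write $t\bowtie_n t'$ if $t\triangleleft_n t'$ and $t'\triangleleft_n t$. For a sequence of trees with $t_n\triangleleft_n t_{n+1}$ for all $n$, $\bigvee_{n\in\mathbb{N}}t_n$ denotes the (existing and unique) tree $t$ such that $t_n\triangleleft_n t$ for all $n$ and $t\triangleleft t'$ for every tree $t'$ with $t_n\triangleleft_n t'$ for all $n$. An approximating (resp. strongly approximating) proof sequence for $j$ is a sequence $(t_n)_{n\in\mathbb{N}}$ of proof trees for $j$ with $t_n\in\mathcal{T}_n$ and $t_n\triangleleft_n t_{n+1}$ (resp. $t_n\bowtie_n t_{n+1}$) for all $n\in\mathbb{N}$. -}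

module Defs where

open import Level using (Level; _⊔_) renaming (suc to lsuc)
open import Data.List using (List; []; _∷_; [_]; _∷ʳ_; length)
open import Data.List.Membership.Propositional using () renaming (_∈_ to _∈ₗ_)
open import Data.List.Relation.Binary.Prefix.Heterogeneous using (Prefix)
open import Data.Nat using (ℕ; zero; suc; _≤_)
open import Data.Product using (Σ; ∃-syntax; _×_; _,_; proj₁; proj₂)
open import Data.Sum using (_⊎_; inj₁; inj₂)
open import Relation.Binary.PropositionalEquality using (_≡_; refl)
open import Relation.Unary using (Pred; _∈_; _⊆_; _≐_; ∅)

private variable
  ℓ s : Level
  U : Set ℓ

-- Subsets are predicates, and equality of subsets is _≐_ throughout.
-- A rule is a pair (premises , conclusion).  A set of rules is a predicate in
-- Set (lsuc ℓ), so that it can be restricted to Ind I, which quantifies over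
-- rules.

Rule : Set ℓ → Set (lsuc ℓ)
Rule {ℓ} U = Pred U ℓ × U

InferenceSystem : Set ℓ → Set (lsuc (lsuc ℓ))
InferenceSystem {ℓ} U = Pred (Rule U) (lsuc ℓ)

F : {U : Set ℓ} → InferenceSystem U → Pred U s → Pred U (lsuc ℓ ⊔ s)
F I S c = ∃[ Pr ] ((Pr , c) ∈ I × Pr ⊆ S)

data Ind {U : Set ℓ} (I : InferenceSystem U) : Pred U (lsuc ℓ) where
  fold : F I (Ind I) ⊆ Ind I

-- The greatest fixed point, as the union of all post-fixed points S ⊆ F I S.
-- Taking S in Pred U ℓ is no restriction on size: see CoInd-greatest.
CoInd : {U : Set ℓ} → InferenceSystem U → Pred U (lsuc ℓ)
CoInd {ℓ} {U} I u = Σ (Pred U ℓ) λ S → S ⊆ F I S × u ∈ S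

infixl 6 _⊔ᵢ_ _⊓ᵢ_

_⊔ᵢ_ : {U : Set ℓ} → InferenceSystem U → Pred U ℓ → InferenceSystem U
(I ⊔ᵢ γ) (Pr , c) = (Pr , c) ∈ I ⊎ (Pr ≐ ∅ × c ∈ γ)

_⊓ᵢ_ : {U : Set ℓ} → InferenceSystem U → Pred U (lsuc ℓ) → InferenceSystem U
(I ⊓ᵢ S) (Pr , c) = (Pr , c) ∈ I × c ∈ S

Gen : {U : Set ℓ} → InferenceSystem U → Pred U ℓ → Pred U (lsuc ℓ)
Gen I γ = CoInd (I ⊓ᵢ Ind (I ⊔ᵢ γ))

-- Ind I and CoInd I are indeed the least and the greatest fixed point of F I.

Ind-fixed : {U : Set ℓ} (I : InferenceSystem U) → Ind I ≐ F I (Ind I)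
Ind-fixed I = (λ { (fold x) → x }) , fold

Ind-least : {U : Set ℓ} (I : InferenceSystem U) (S : Pred U s) →
            F I S ⊆ S → Ind I ⊆ S
Ind-least I S closed (fold (Pr , r , f)) =
  closed (Pr , r , λ q → Ind-least I S closed (f q))

CoInd-fixed : {U : Set ℓ} (I : InferenceSystem U) → CoInd I ≐ F I (CoInd I)
CoInd-fixed {ℓ} {U} I = unfold , refold
  where
  unfold : CoInd I ⊆ F I (CoInd I)
  unfold (S , post , u∈S) with post u∈S
  ... | Pr , r , f = Pr , r , λ q → S , post , f q

  refold : F I (CoInd I) ⊆ CoInd I
  refold {u} (Pr , r , f) = S , post , inj₁ refl
    where
    S : Pred U ℓ
    S v = v ≡ u ⊎ (∃[ p ] Σ (p ∈ Pr) λ q → v ∈ proj₁ (f q))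

    post : S ⊆ F I S
    post (inj₁ refl) = Pr , r , λ {p} q → inj₂ (p , q , proj₂ (proj₂ (f q)))
    post (inj₂ (p , q , v∈)) with proj₁ (proj₂ (f q)) v∈
    ... | Pr′ , r′ , g = Pr′ , r′ , λ w∈ → inj₂ (p , q , g w∈)

CoInd-greatest : {U : Set ℓ} (I : InferenceSystem U) (S : Pred U s) →
                 S ⊆ F I S → S ⊆ CoInd I
CoInd-greatest {ℓ} {s} {U} I S post {u} u∈S =
  (λ v → ∃[ n ] Reach n u∈S v) ,
  (λ { (n , x) → reach-post n u∈S x }) ,
  (zero , refl)
  where
  Reach : ℕ → {v : U} → v ∈ S → Pred U ℓ
  Reach zero    {v} _   w = w ≡ v
  Reach (suc n) {v} v∈S w =
    ∃[ p ] Σ (p ∈ proj₁ (post v∈S)) λ q → Reach n (proj₂ (proj₂ (post v∈S)) q) w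

  reach-post : ∀ n {v} (v∈S : v ∈ S) {w} → Reach n v∈S w →
               F I (λ x → ∃[ m ] Reach m v∈S x) w
  reach-post zero v∈S refl =
    proj₁ (post v∈S) , proj₁ (proj₂ (post v∈S)) , λ {p} q → 1 , p , q , refl
  reach-post (suc n) v∈S (p , q , x) with reach-post n _ x
  ... | Pr , r , f = Pr , r , λ y → suc (proj₁ (f y)) , p , q , proj₂ (f y)

-- Children injective trees labelled in U, in canonical form: the alphabet is U
-- and the label of α a is a, so the labelling is determined by its root.

record Tree (U : Set ℓ) : Set (lsuc ℓ) where
  field
    root          : U
    dom           : Pred (List U) ℓ
    ε∈dom         : [] ∈ dom
    prefix-closed : ∀ {α a} → α ∷ʳ a ∈ dom → α ∈ dom

open Tree public

-- The last symbol of the string; the first argument is the label of ε.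
lastSymbol : U → List U → U
lastSymbol r []      = r
lastSymbol r (a ∷ α) = lastSymbol a α

label : Tree U → List U → U
label t = lastSymbol (root t)

label-∷ʳ : (t : Tree U) (α : List U) (a : U) → label t (α ∷ʳ a) ≡ a
label-∷ʳ t = go (root t)
  where
  go : ∀ r α a → lastSymbol r (α ∷ʳ a) ≡ a
  go r []      a = refl
  go r (b ∷ α) a = go b α a

chl : {U : Set ℓ} → Tree U → List U → Pred (List U) ℓ
chl t α β = β ∈ dom t × (∃[ a ] β ≡ α ∷ʳ a)

-- The image t(chl_t(α)).
chlLabels : {U : Set ℓ} → Tree U → List U → Pred U ℓ
chlLabels t α u = ∃[ β ] (β ∈ chl t α × label t β ≡ u)

subtree : (t : Tree U) (i : U) → [ i ] ∈ dom t → Tree U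
subtree t i [i]∈dom = record
  { root          = i
  ; dom           = λ α → i ∷ α ∈ dom t
  ; ε∈dom         = [i]∈dom
  ; prefix-closed = prefix-closed t
  }

IsChain : {U : Set ℓ} → Pred (List U) ℓ → Set ℓ
IsChain C = ∀ {α β} → α ∈ C → β ∈ C → Prefix _≡_ α β ⊎ Prefix _≡_ β α

Finite : {A : Set ℓ} → Pred A ℓ → Set ℓ
Finite C = ∃[ xs ] C ≐ (_∈ₗ xs)

IsWellFounded : {U : Set ℓ} → Tree U → Set (lsuc ℓ)
IsWellFounded {ℓ} {U} t = (C : Pred (List U) ℓ) → C ⊆ dom t → IsChain C → Finite C

IsProofTree : {U : Set ℓ} → InferenceSystem U → Tree U → Set (lsuc ℓ)
IsProofTree I t =
  ∀ {α} → α ∈ dom t → ∃[ Pr ] ((Pr , label t α) ∈ I × chlLabels t α ≐ Pr)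

-- In canonical form the direct subtree containing the node i has root i, so the
-- direct subtrees form a family (t_i) with t_i(ε) = i indexed by the labels of
-- the children of ε; this family is indexed by Pr when those labels are Pr.
𝒯 : {U : Set ℓ} → InferenceSystem U → Pred U ℓ → ℕ → Pred (Tree U) (lsuc ℓ)
𝒯 I γ zero    t = IsWellFounded t × IsProofTree (I ⊔ᵢ γ) t
𝒯 I γ (suc n) t =
  ∃[ Pr ] ((Pr , root t) ∈ I × chlLabels t [] ≐ Pr ×
           (∀ i ([i]∈dom : [ i ] ∈ dom t) → subtree t i [i]∈dom ∈ 𝒯 I γ n))

dom≤ : {U : Set ℓ} → ℕ → Tree U → Pred (List U) ℓ
dom≤ n t α = α ∈ dom t × length α ≤ n

infix 4 _◁_ _◁[_]_ _⋈[_]_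

_◁_ : {U : Set ℓ} → Tree U → Tree U → Set ℓ
t ◁ t′ = dom t ⊆ dom t′ × (∀ {α} → α ∈ dom t → label t α ≡ label t′ α)

_◁[_]_ : {U : Set ℓ} → Tree U → ℕ → Tree U → Set ℓ
t ◁[ n ] t′ = dom≤ n t ⊆ dom≤ n t′ × (∀ {α} → α ∈ dom≤ n t → label t α ≡ label t′ α)

_⋈[_]_ : {U : Set ℓ} → Tree U → ℕ → Tree U → Set ℓ
t ⋈[ n ] t′ = t ◁[ n ] t′ × t′ ◁[ n ] t

-- t = ⋁ₙ tₙ (such a t is unique up to equality of roots and _≐_ of domains).
IsJoin : {U : Set ℓ} → (ℕ → Tree U) → Tree U → Set (lsuc ℓ)
IsJoin ts t = (∀ n → ts n ◁[ n ] t) × (∀ t′ → (∀ n → ts n ◁[ n ] t′) → t ◁ t′)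

-- Proof trees for j belonging to 𝒯ₙ.  They are proof trees in I ⊔ᵢ γ, since
-- they may use coaxioms.
ApproximatedProofs : {U : Set ℓ} → InferenceSystem U → Pred U ℓ → U →
                     (ℕ → Tree U) → Set (lsuc ℓ)
ApproximatedProofs I γ j ts =
  ∀ n → IsProofTree (I ⊔ᵢ γ) (ts n) × root (ts n) ≡ j × ts n ∈ 𝒯 I γ n

IsApproximating : {U : Set ℓ} → InferenceSystem U → Pred U ℓ → U →
                  (ℕ → Tree U) → Set (lsuc ℓ)
IsApproximating I γ j ts =
  ApproximatedProofs I γ j ts × (∀ n → ts n ◁[ n ] ts (suc n))

IsStronglyApproximating : {U : Set ℓ} → InferenceSystem U → Pred U ℓ → U →
                          (ℕ → Tree U) → Set (lsuc ℓ)
IsStronglyApproximating I γ j ts =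
  ApproximatedProofs I γ j ts × (∀ n → ts n ⋈[ n ] ts (suc n))

{-# OPTIONS --safe #-}

-- (1) ⇒ (2): a post-fixed point S of the restricted system gives every u ∈ S a
-- rule of I with premises in S and a finite proof in I ⊔ᵢ γ; unfolding the rules
-- n times and then plugging in the finite proofs yields tₙ.
-- (2) ⇒ (3): the levels ≤ n + 1 of the join are those of tₙ₊₁, whose nodes at
-- levels ≤ n are justified by rules of I.
-- (3) ⇒ (1): the labels of the join form a post-fixed point of I, and each of
-- them occurs in some tₙ, hence belongs to Ind (I ⊔ᵢ γ), because on a tree
-- without infinite chains the child relation is classically well-founded.

module Submission where

open import Defs
open import Axiom.ExcludedMiddle using (ExcludedMiddle)
open import Data.Empty using (⊥; ⊥-elim)
open import Data.List using (List; []; _∷_; [_]; _∷ʳ_; _++_; length; map)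
open import Data.List.Extrema.Nat using (max; xs≤max)
open import Data.List.Membership.Propositional using () renaming (_∈_ to _∈ₗ_)
open import Data.List.Membership.Propositional.Properties using (∈-map⁺; ∈-map⁻)
open import Data.List.Properties using (++-identityʳ; ∷ʳ-++; length-++-sucʳ; length-++-≤ˡ)
import Data.List.Relation.Binary.Pointwise as Pointwise
open import Data.List.Relation.Binary.Prefix.Heterogeneous using (Prefix; []; _∷_)
open import Data.List.Relation.Binary.Prefix.Heterogeneous.Properties using (fromPointwise)
open import Data.List.Relation.Unary.All using (lookup)
open import Data.List.Relation.Unary.Any using (here; there)
open import Data.Nat using (ℕ; zero; suc; _≤_; _<_; _≤′_; ≤′-refl; ≤′-step; z≤n; s≤s)
open import Data.Nat.Properties using (≤-trans; ≤-total; ≤⇒≤′; ≤′⇒≤; m≤n⇒m≤1+n; <-irrefl)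
open import Data.Product using (Σ; ∃-syntax; _×_; _,_; proj₁; proj₂)
open import Data.Sum using (_⊎_; inj₁; inj₂)
open import Data.Unit.Polymorphic using (⊤; tt)
open import Function.Base using (_∘_)
open import Function.Bundles using (_⇔_; mk⇔)
open import Induction.WellFounded using (Acc; acc)
open import Level using (Level)
open import Relation.Binary.PropositionalEquality using (_≡_; refl; sym; trans; cong; subst)
open import Relation.Nullary using (¬_; Dec; yes; no)
open import Relation.Nullary.Decidable using (decidable-stable; recompute)
open import Relation.Unary using (Pred; _∈_; _⊆_; _≐_)

private variable
  ℓ : Level
  U : Set ℓ
  t t′ : Tree U

-- Strings, equality of trees, and the rules at their nodes.

length-∷ʳ : (α : List U) (a : U) → length (α ∷ʳ a) ≡ suc (length α)
length-∷ʳ α a = trans (length-++-sucʳ α a []) (cong (suc ∘ length) (++-identityʳ α))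

prefix-++ : {α β δ : List U} → Prefix _≡_ α β → Prefix _≡_ α (β ++ δ)
prefix-++ []      = []
prefix-++ (e ∷ p) = e ∷ prefix-++ p

dom-++ˡ : (t : Tree U) {α : List U} (β : List U) → α ++ β ∈ dom t → α ∈ dom t
dom-++ˡ t {α} [] x = subst (_∈ dom t) (++-identityʳ α) x
dom-++ˡ t {α} (b ∷ β) x =
  prefix-closed t (dom-++ˡ t β (subst (_∈ dom t) (sym (∷ʳ-++ α b β)) x))

label-cong : root t ≡ root t′ → ∀ α → label t α ≡ label t′ α
label-cong e α = cong (λ r → lastSymbol r α) e

infix 4 _≈_

-- Equality of labelled trees: the label of a nonempty node is its last symbol, so only the root
-- label is free. The direct subtrees of a grafted tree match the given trees in this sense.
_≈_ : {U : Set ℓ} → Tree U → Tree U → Set ℓ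
t ≈ t′ = root t ≡ root t′ × dom t ≐ dom t′

chlLabels-resp : root t ≡ root t′ → dom t ⊆ dom t′ → ∀ α → chlLabels t α ⊆ chlLabels t′ α
chlLabels-resp {t = t} {t′ = t′} e d α (β , (x , c) , eq) =
  β , (d x , c) , trans (sym (label-cong {t = t} {t′ = t′} e β)) eq

isWellFounded-⊆ : dom t′ ⊆ dom t → IsWellFounded t → IsWellFounded t′
isWellFounded-⊆ d wf C C⊆ = wf C (d ∘ C⊆)

isProofTree-resp : {I : InferenceSystem U} {t t′ : Tree U} →
                   t ≈ t′ → IsProofTree I t → IsProofTree I t′
isProofTree-resp {I = I} {t} {t′} (e , d , d′) p {α} x with p (d′ x)
... | Pr , r , c , c′ =
  Pr , subst (λ u → (Pr , u) ∈ I) (label-cong {t = t} {t′ = t′} e α) r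
  , c ∘ chlLabels-resp {t = t′} {t′ = t} (sym e) d′ α
  , chlLabels-resp {t = t} {t′ = t′} e d α ∘ c′

𝒯-resp : {U : Set ℓ} {I : InferenceSystem U} {γ : Pred U ℓ} → ∀ n {t t′ : Tree U} →
         t ≈ t′ → t ∈ 𝒯 I γ n → t′ ∈ 𝒯 I γ n
𝒯-resp {I = I} {γ} zero {t} {t′} t≈@(_ , _ , d′) (wf , p) =
  isWellFounded-⊆ {t′ = t′} {t = t} d′ wf , isProofTree-resp {I = I ⊔ᵢ γ} {t = t} {t′} t≈ p
𝒯-resp {I = I} (suc n) {t} {t′} (e , d , d′) (Pr , r , (c , c′) , sub) =
  Pr , subst (λ u → (Pr , u) ∈ I) e r
  , ( c ∘ chlLabels-resp {t = t′} {t′ = t} (sym e) d′ []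
    , chlLabels-resp {t = t} {t′ = t′} e d [] ∘ c′)
  , λ i x → 𝒯-resp n {subtree t i (d′ x)} {subtree t′ i x} (refl , d , d′) (sub i (d′ x))

chlLabels-subtree : {U : Set ℓ} {Pr : Pred U ℓ} (t : Tree U) {i : U} {α : List U} (x : [ i ] ∈ dom t) →
                    chlLabels (subtree t i x) α ≐ Pr → chlLabels t (i ∷ α) ≐ Pr
chlLabels-subtree t {i} x (c , c′) =
  (λ { (_ , (y , a , refl) , eq) → c (_ , (y , a , refl) , eq) }) ,
  (λ q → let β , (y , a , eq₁) , eq₂ = c′ q in
         i ∷ β , (y , a , cong (i ∷_) eq₁) , eq₂)

isProofTree-node : {U : Set ℓ} {Pr : Pred U ℓ} (I : InferenceSystem U) (t : Tree U) →
                   (Pr , root t) ∈ I → chlLabels t [] ≐ Pr →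
                   (∀ i (x : [ i ] ∈ dom t) → IsProofTree I (subtree t i x)) →
                   IsProofTree I t
isProofTree-node {Pr = Pr} I t r c sub {[]} _ = Pr , r , c
isProofTree-node I t r c sub {i ∷ α} x with sub i (dom-++ˡ t α x) x
... | Pr , r′ , c′ = Pr , r′ , chlLabels-subtree t (dom-++ˡ t α x) c′

𝒯⇒isProofTree : {U : Set ℓ} {I : InferenceSystem U} {γ : Pred U ℓ} → ∀ n {t : Tree U} →
                t ∈ 𝒯 I γ n → IsProofTree (I ⊔ᵢ γ) t
𝒯⇒isProofTree zero (_ , p) = p
𝒯⇒isProofTree {I = I} {γ} (suc n) {t} (Pr , r , c , sub) =
  isProofTree-node (I ⊔ᵢ γ) t (inj₁ r) c λ i x → 𝒯⇒isProofTree n (sub i x)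

-- A tree of level `n` consists of `n` layers of rules of `I` on top of trees of level 0, so
-- coaxioms can justify only nodes of depth at least `n`.
𝒯-rule : {U : Set ℓ} {I : InferenceSystem U} {γ : Pred U ℓ} → ∀ n {t : Tree U} → t ∈ 𝒯 I γ n →
         ∀ {α} → α ∈ dom t → length α < n →
         ∃[ Pr ] ((Pr , label t α) ∈ I × chlLabels t α ≐ Pr)
𝒯-rule (suc n) (Pr , r , c , sub) {[]} _ _ = Pr , r , c
𝒯-rule (suc n) {t} (_ , _ , _ , sub) {i ∷ α} x (s≤s α<n)
  with 𝒯-rule n (sub i (dom-++ˡ t α x)) x α<n
... | Pr , r , c = Pr , r , chlLabels-subtree t (dom-++ˡ t α x) c

-- The join of a sequence of trees.

module Join {U : Set ℓ} (ts : ℕ → Tree U) where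

  join : Tree U
  join = record
    { root          = root (ts 0)
    ; dom           = λ α → ∃[ n ] (α ∈ dom≤ n (ts n))
    ; ε∈dom         = 0 , ε∈dom (ts 0) , z≤n
    ; prefix-closed = λ { {α} (n , x , l) →
        n , prefix-closed (ts n) x , ≤-trans (length-++-≤ˡ α) l }
    }

  module _ {j} (roots : ∀ n → root (ts n) ≡ j) where

    ◁-join : ∀ n → ts n ◁[ n ] join
    ◁-join n = (λ { (x , l) → (n , x , l) , l }) ,
      λ {α} _ → label-cong {t = ts n} {t′ = join} (trans (roots n) (sym (roots 0))) α

    -- Every upper bound contains each truncation `dom≤ n (ts n)`, hence their union. Comparing at
    -- the empty string equates the roots, and these determine all labels.
    isJoin : IsJoin ts join
    isJoin = ◁-join , λ t′ ub →
      (λ { (n , x) → proj₁ (proj₁ (ub n) x) }) ,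
      λ {α} _ → label-cong {t = join} {t′ = t′} (proj₂ (ub 0) (ε∈dom (ts 0) , z≤n)) α

    isProofTree-join : {I : InferenceSystem U} {γ : Pred U ℓ} →
      (∀ n → ts n ∈ 𝒯 I γ n) → (∀ n → ts n ⋈[ n ] ts (suc n)) → IsProofTree I join
    isProofTree-join {I} approx strong {α} (n , x , l)
      -- Index `suc n` serves two purposes: `𝒯-rule` needs the length of `α` strictly below the
      -- level, and the children of `α`, of length up to `suc n`, must survive the truncation.
      with 𝒯-rule (suc n) {ts (suc n)} (approx (suc n)) (proj₁ (proj₁ (proj₁ (strong n)) (x , l))) (s≤s l)
    ... | Pr , r , c , c′ =
      Pr , subst (λ u → (Pr , u) ∈ I) (label-cong {t = ts (suc n)} {t′ = join} e α) r , to , from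
      where
      e : root (ts (suc n)) ≡ root join
      e = trans (roots (suc n)) (sym (roots 0))

      up : ∀ {β k m} → k ≤′ m → β ∈ dom≤ k (ts k) → β ∈ dom≤ m (ts m)
      up ≤′-refl y = y
      up (≤′-step k≤m) y =
        let z , l = proj₁ (proj₁ (strong _)) (up k≤m y) in z , m≤n⇒m≤1+n l

      -- This direction uses the half of `⋈` that distinguishes strong approximation. Passing from
      -- `ts (suc m)` to `ts m` is controlled only up to length `m`, hence the bound on `β`.
      down : ∀ {β k m} → k ≤′ m → length β ≤ k → β ∈ dom (ts m) → β ∈ dom (ts k)
      down ≤′-refl _ y = y
      down (≤′-step k≤m) l y =
        down k≤m l (proj₁ (proj₁ (proj₂ (strong _)) (y , ≤-trans l (≤′⇒≤ k≤m))))

      move : ∀ {β} k m → length β ≤ m → β ∈ dom≤ k (ts k) → β ∈ dom (ts m)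
      move k m l y with ≤-total k m
      ... | inj₁ k≤m = proj₁ (up (≤⇒≤′ k≤m) y)
      ... | inj₂ m≤k = down (≤⇒≤′ m≤k) l (proj₁ y)

      child-length : ∀ a → length (α ∷ʳ a) ≤ suc n
      child-length a = subst (_≤ suc n) (sym (length-∷ʳ α a)) (s≤s l)

      to : chlLabels join α ⊆ Pr
      to (_ , ((k , y) , a , refl) , eq) =
        c (_ , (move k (suc n) (child-length a) y , a , refl)
          , trans (label-cong {t = ts (suc n)} {t′ = join} e (α ∷ʳ a)) eq)

      from : Pr ⊆ chlLabels join α
      from q with c′ q
      ... | _ , (y , a , refl) , eq =
        _ , ((suc n , y , child-length a) , a , refl)
        , trans (sym (label-cong {t = ts (suc n)} {t′ = join} e (α ∷ʳ a))) eq

-- Grafting, and the trees of inductive derivations.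

module _ (em : ExcludedMiddle ℓ) {U : Set ℓ} where

  -- Distinct proofs of i ∈ Pr may select distinct trees; recompute picks one
  -- proof for each i, so that the result has a single subtree at i.
  graft : (c : U) (Pr : Pred U ℓ) → (∀ {i} → i ∈ Pr → Tree U) → Tree U
  graft c Pr ts = record
    { root          = c
    ; dom           = D
    ; ε∈dom         = tt
    ; prefix-closed = λ {α} → closed {α}
    }
    where
    D : Pred (List U) ℓ
    D []      = ⊤
    D (i ∷ α) = Σ (i ∈ Pr) λ q → α ∈ dom (ts (recompute em q))

    closed : ∀ {α a} → α ∷ʳ a ∈ D → α ∈ D
    closed {[]}    _       = tt
    closed {i ∷ α} (q , x) = q , prefix-closed (ts (recompute em q)) x

  module _ (c : U) {Pr : Pred U ℓ} (ts : ∀ {i} → i ∈ Pr → Tree U) where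

    chlLabels-graft : chlLabels (graft c Pr ts) [] ≐ Pr
    chlLabels-graft =
      (λ { (_ , ((q , _) , _ , refl) , refl) → q }) ,
      (λ {i} q → [ i ] , ((q , ε∈dom (ts (recompute em q))) , i , refl) , refl)

    subtree-graft : (∀ {i} (q : i ∈ Pr) → root (ts q) ≡ i) →
                    ∀ i (x : [ i ] ∈ dom (graft c Pr ts)) →
                    ts (recompute em (proj₁ x)) ≈ subtree (graft c Pr ts) i x
    -- `recompute` is irrelevant in its proof argument, so all proofs of `i ∈ Pr` select
    -- definitionally the same tree.
    subtree-graft roots i (q , _) = roots _ , (λ y → q , y) , proj₂

    -- Comparable nonempty strings share their first symbol `i`, so the tails of a chain form a
    -- chain in the one subtree at `i`, which is finite. Excluded middle decides which strings
    -- besides these tails have to be listed.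
    isWellFounded-graft : (∀ {i} (q : i ∈ Pr) → IsWellFounded (ts q)) →
                          IsWellFounded (graft c Pr ts)
    isWellFounded-graft wf C C⊆ chain with em {∃[ i ] ∃[ α ] (i ∷ α) ∈ C}
    ... | no none with em {[] ∈ C}
    ...   | yes ε∈C = [ [] ] ,
            (λ { {[]} _ → here refl ; {i ∷ α} y → ⊥-elim (none (i , α , y)) }) ,
            (λ { (here refl) → ε∈C })
    ...   | no ε∉C = [] ,
            (λ { {[]} y → ⊥-elim (ε∉C y) ; {i ∷ α} y → ⊥-elim (none (i , α , y)) }) ,
            (λ ())
    isWellFounded-graft wf C C⊆ chain | yes (i , α , y) = with-ε (em {[] ∈ C})
      where
      head≡ : ∀ {k β} → (k ∷ β) ∈ C → k ≡ i
      head≡ z with chain y z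
      ... | inj₁ (e ∷ _) = sym e
      ... | inj₂ (e ∷ _) = e

      tails : Finite (λ β → (i ∷ β) ∈ C)
      tails = wf (recompute em (proj₁ (C⊆ y))) _ (λ z → proj₂ (C⊆ z)) λ z w → tail (chain z w)
        where
        tail : ∀ {β δ} → Prefix _≡_ (i ∷ β) (i ∷ δ) ⊎ Prefix _≡_ (i ∷ δ) (i ∷ β) →
               Prefix _≡_ β δ ⊎ Prefix _≡_ δ β
        tail (inj₁ (_ ∷ p)) = inj₁ p
        tail (inj₂ (_ ∷ p)) = inj₂ p

      xs : List (List U)
      xs = map (i ∷_) (proj₁ tails)

      cons⁺ : ∀ {k β} → (k ∷ β) ∈ C → (k ∷ β) ∈ₗ xs
      cons⁺ z with head≡ z
      ... | refl = ∈-map⁺ (i ∷_) (proj₁ (proj₂ tails) z)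

      cons⁻ : ∀ {β} → β ∈ₗ xs → β ∈ C
      cons⁻ z with ∈-map⁻ (i ∷_) z
      ... | _ , w , refl = proj₂ (proj₂ tails) w

      with-ε : Dec ([] ∈ C) → Finite C
      with-ε (yes ε∈C) = [] ∷ xs ,
        (λ { {[]} _ → here refl ; {_ ∷ _} z → there (cons⁺ z) }) ,
        (λ { (here refl) → ε∈C ; (there z) → cons⁻ z })
      with-ε (no ε∉C) = xs ,
        (λ { {[]} z → ⊥-elim (ε∉C z) ; {_ ∷ _} z → cons⁺ z }) ,
        cons⁻

  module _ {I : InferenceSystem U} where

    indTree : ∀ {u} → u ∈ Ind I → Tree U
    indTree {u} (fold (Pr , _ , f)) = graft u Pr λ q → indTree (f q)

    root-indTree : ∀ {u} (d : u ∈ Ind I) → root (indTree d) ≡ u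
    root-indTree (fold _) = refl

    isWellFounded-indTree : ∀ {u} (d : u ∈ Ind I) → IsWellFounded (indTree d)
    isWellFounded-indTree {u} (fold (Pr , _ , f)) =
      isWellFounded-graft u (λ q → indTree (f q)) λ q → isWellFounded-indTree (f q)

    isProofTree-indTree : ∀ {u} (d : u ∈ Ind I) → IsProofTree I (indTree d)
    isProofTree-indTree {u} d@(fold (Pr , r , f)) =
      isProofTree-node I (indTree d) r (chlLabels-graft u ts) λ i x →
        isProofTree-resp {I = I} {ts (recompute em (proj₁ x))} {subtree (indTree d) i x}
          (subtree-graft u ts (λ q → root-indTree (f q)) i x)
          (isProofTree-indTree (f (recompute em (proj₁ x))))
      where
      ts : ∀ {i} → i ∈ Pr → Tree U
      ts q = indTree (f q)

  -- From finite chains to accessibility and inductive derivability.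

  module _ (t : Tree U) where

    private
      _⊰_ : List U → List U → Set ℓ
      β ⊰ α = β ∈ chl t α

    -- A node that is not accessible has a child that is not accessible. Iterating yields a branch
    -- with nodes of unbounded length, which no finite list can contain.
    isWellFounded⇒acc : IsWellFounded t → ∀ α → α ∈ dom t → Acc _⊰_ α
    isWellFounded⇒acc wf α α∈ = decidable-stable em infinite
      where
      Bad : Set ℓ
      Bad = ∃[ β ] (β ∈ dom t × ¬ Acc _⊰_ β)

      -- Excluded middle returns an actual child, so that `path` can iterate `next` as a function.
      next : ((β , _) : Bad) → ∃[ a ] (β ∷ʳ a ∈ dom t × ¬ Acc _⊰_ (β ∷ʳ a))
      next (β , β∈ , ¬acc) = decidable-stable em λ none →
        ¬acc (acc λ { (x , a , refl) → decidable-stable em λ ¬acc′ → none (a , x , ¬acc′) })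

      module _ (¬acc : ¬ Acc _⊰_ α) where

        path : ℕ → Bad
        path zero    = α , α∈ , ¬acc
        path (suc k) = let a , x , b = next (path k) in proj₁ (path k) ∷ʳ a , x , b

        node : ℕ → List U
        node k = proj₁ (path k)

        length-node : ∀ k → k ≤ length (node k)
        length-node zero    = z≤n
        length-node (suc k) = subst (suc k ≤_) (sym (length-∷ʳ (node k) _)) (s≤s (length-node k))

        node-prefix : ∀ {k m} → k ≤′ m → Prefix _≡_ (node k) (node m)
        node-prefix ≤′-refl       = fromPointwise (Pointwise.refl refl)
        node-prefix (≤′-step k≤m) = prefix-++ (node-prefix k≤m)

        Path : Pred (List U) ℓ
        Path β = ∃[ k ] β ≡ node k

        path-chain : IsChain Path
        path-chain (k , refl) (m , refl) with ≤-total k m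
        ... | inj₁ k≤m = inj₁ (node-prefix (≤⇒≤′ k≤m))
        ... | inj₂ m≤k = inj₂ (node-prefix (≤⇒≤′ m≤k))

        infinite : ⊥
        infinite with wf Path (λ { (k , refl) → proj₁ (proj₂ (path k)) }) path-chain
        ... | xs , to , _ = <-irrefl refl (≤-trans (length-node bound) node≤)
          where
          -- Exceeds every length in `xs`, with 0 as the default for an empty list; yet `node bound`
          -- lies in `xs` and has length at least `bound`.
          bound : ℕ
          bound = suc (max 0 (map length xs))

          node≤ : length (node bound) ≤ max 0 (map length xs)
          node≤ = lookup (xs≤max 0 (map length xs)) (∈-map⁺ length (to (bound , refl)))

    acc⇒label∈Ind : {I : InferenceSystem U} → IsProofTree I t →
                    ∀ {α} → Acc _⊰_ α → α ∈ dom t → label t α ∈ Ind I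
    acc⇒label∈Ind {I} p {α} (acc rs) x with p x
    ... | Pr , r , _ , c′ = fold (Pr , r , λ q →
      let β , chl , eq = c′ q in
      subst (_∈ Ind I) eq (acc⇒label∈Ind p (rs chl) (proj₁ chl)))

  -- The layers of rules of `I` are peeled off by induction on `n`, down to well-founded trees,
  -- where accessibility provides the induction.
  𝒯⇒label∈Ind : {I : InferenceSystem U} {γ : Pred U ℓ} → ∀ n {t} → t ∈ 𝒯 I γ n →
                ∀ {α} → α ∈ dom t → label t α ∈ Ind (I ⊔ᵢ γ)
  𝒯⇒label∈Ind zero {t} (wf , p) x =
    acc⇒label∈Ind t p (isWellFounded⇒acc t wf _ x) x
  𝒯⇒label∈Ind (suc n) (Pr , r , (_ , c′) , sub) {[]} _ = fold (Pr , inj₁ r , premise)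
    where
    premise : Pr ⊆ Ind _
    premise q with c′ q
    ... | _ , (y , i , refl) , refl = 𝒯⇒label∈Ind n (sub i y) {[]} y
  𝒯⇒label∈Ind (suc n) {t} (_ , _ , _ , sub) {i ∷ α} x =
    𝒯⇒label∈Ind n (sub i (dom-++ˡ t α x)) x

  -- Unfolding a post-fixed point of the restricted system.

  module Unfold {I : InferenceSystem U} {γ S : Pred U ℓ}
                (post : S ⊆ F (I ⊓ᵢ Ind (I ⊔ᵢ γ)) S) where

    -- For each `u` in `S`, `post` supplies both a rule of `I` and, as its side condition, a
    -- derivation of `u` in `I ⊔ᵢ γ`. The derivation is used at level 0, the rule above it.
    unfold : ℕ → ∀ {u} → u ∈ S → Tree U
    unfold zero    s = let _ , (_ , d) , _ = post s in indTree d
    unfold (suc n) {u} s = let Pr , _ , f = post s in graft u Pr λ q → unfold n (f q)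

    root-unfold : ∀ n {u} (s : u ∈ S) → root (unfold n s) ≡ u
    root-unfold zero    s = root-indTree (proj₂ (proj₁ (proj₂ (post s))))
    root-unfold (suc n) s = refl

    unfold∈𝒯 : ∀ n {u} (s : u ∈ S) → unfold n s ∈ 𝒯 I γ n
    unfold∈𝒯 zero s = let _ , (_ , d) , _ = post s in
      isWellFounded-indTree d , isProofTree-indTree d
    unfold∈𝒯 (suc n) {u} s = let Pr , (r , _) , f = post s in
      Pr , r , chlLabels-graft u (λ q → unfold n (f q)) , λ i x →
        𝒯-resp n {unfold n (f (recompute em (proj₁ x)))} {subtree (unfold (suc n) s) i x}
          (subtree-graft u (λ q → unfold n (f q)) (λ q → root-unfold n (f q)) i x)
          (unfold∈𝒯 n (f (recompute em (proj₁ x))))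

    -- Both trees apply the same rules in their top `n` layers. They can differ only strictly below
    -- depth `n`, where one continues with a derivation and the other with one more rule.
    unfold-step : ∀ n {u} (s : u ∈ S) →
                  (∀ {α} → length α ≤ n → α ∈ dom (unfold n s) → α ∈ dom (unfold (suc n) s)) ×
                  (∀ {α} → length α ≤ n → α ∈ dom (unfold (suc n) s) → α ∈ dom (unfold n s))
    unfold-step zero s =
      (λ { {[]} _ _ → tt }) , (λ { {[]} _ _ → ε∈dom (unfold 0 s) })
    unfold-step (suc n) s =
      (λ { {[]} _ _ → tt
         ; {_ ∷ _} (s≤s l) (q , x) → q , proj₁ (unfold-step n _) l x }) ,
      (λ { {[]} _ _ → tt
         ; {_ ∷ _} (s≤s l) (q , x) → q , proj₂ (unfold-step n _) l x })

    isStronglyApproximating-unfold : ∀ {u} (s : u ∈ S) →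
                                     IsStronglyApproximating I γ u (λ n → unfold n s)
    isStronglyApproximating-unfold s =
      (λ n → 𝒯⇒isProofTree n (unfold∈𝒯 n s) , root-unfold n s , unfold∈𝒯 n s) ,
      λ n → let e = trans (root-unfold n s) (sym (root-unfold (suc n) s)) in
        ( (λ { (x , l) → proj₁ (unfold-step n s) l x , l })
        , λ {α} _ → label-cong {t = unfold n s} {t′ = unfold (suc n) s} e α)
      , ( (λ { (x , l) → proj₂ (unfold-step n s) l x , l })
        , λ {α} _ → label-cong {t = unfold (suc n) s} {t′ = unfold n s} (sym e) α)

  -- The three implications.

  module _ {I : InferenceSystem U} {γ : Pred U ℓ} {j : U} where

    gen⇒strong : j ∈ Gen I γ → ∃[ ts ] IsStronglyApproximating I γ j ts
    gen⇒strong (_ , post , s) = _ , Unfold.isStronglyApproximating-unfold post s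

    strong⇒join : ∃[ ts ] IsStronglyApproximating I γ j ts →
                  ∃[ ts ] (IsApproximating I γ j ts × (∃[ t ] (IsJoin ts t × IsProofTree I t)))
    strong⇒join (ts , approx , strong) =
      ts , (approx , proj₁ ∘ strong) ,
      join , isJoin roots , isProofTree-join roots (proj₂ ∘ proj₂ ∘ approx) strong
      where
      open Join ts
      roots = proj₁ ∘ proj₂ ∘ approx

    join⇒gen : ∃[ ts ] (IsApproximating I γ j ts × (∃[ t ] (IsJoin ts t × IsProofTree I t))) →
               j ∈ Gen I γ
    join⇒gen (ts , (approx , _) , t , (ub , least) , p) = Labels , post , [] , ε∈dom t , root≡j
      where
      roots = proj₁ ∘ proj₂ ∘ approx

      Labels : Pred U ℓ
      Labels u = ∃[ α ] (α ∈ dom t × label t α ≡ u)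

      root≡j : root t ≡ j
      root≡j = trans (sym (proj₂ (ub 0) (ε∈dom (ts 0) , z≤n))) (roots 0)

      label∈Ind : ∀ {α} → α ∈ dom t → label t α ∈ Ind (I ⊔ᵢ γ)
      -- Minimality of `t` is applied to the explicit union of truncations, which locates the node
      -- `x` in some `ts n`.
      label∈Ind x with proj₁ (least (Join.join ts) (Join.◁-join ts roots)) x
      ... | n , y = subst (_∈ Ind (I ⊔ᵢ γ)) (proj₂ (ub n) y)
                      (𝒯⇒label∈Ind n (proj₂ (proj₂ (approx n))) (proj₁ y))

      post : Labels ⊆ F (I ⊓ᵢ Ind (I ⊔ᵢ γ)) Labels
      post (α , x , refl) with p x
      ... | Pr , r , _ , c′ = Pr , (r , label∈Ind x) , λ q →
        let β , (y , _) , eq = c′ q in β , y , eq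

theorem4p17 : ∀ {ℓ} → ExcludedMiddle ℓ →
    (U : Set ℓ) (I : InferenceSystem U) (γ : Pred U ℓ) (j : U) →
    (j ∈ Gen I γ ⇔ (∃[ ts ] IsStronglyApproximating I γ j ts)) ×
    (j ∈ Gen I γ ⇔ (∃[ ts ] (IsApproximating I γ j ts × (∃[ t ] (IsJoin ts t × IsProofTree I t)))))
theorem4p17 em U I γ j =
  mk⇔ (gen⇒strong em) (join⇒gen em ∘ strong⇒join em) ,
  mk⇔ (strong⇒join em ∘ gen⇒strong em) (join⇒gen em)
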